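{- (1) There exist a $\mathcal{W}$-positive set $X\subseteq\mathbb{Z}$ and a $\mathbb{Z}$-invariant colouring $c:[\mathbb{Z}]^2\to 2$ such that every $c$-homogeneous set $Y\subseteq X$ belongs to $\mathcal{W}$. (2) For every $k\geq 1$ there exist an $\mathcal{I}_{k\text{ - }\mathsf{thin}}$-positive set $X\subseteq\mathbb{Z}$ and a $\mathbb{Z}$-invariant colouring $c:[\mathbb{Z}]^2\to 2$ such that every $c$-homogeneous set $Y\subseteq X$ belongs to $\mathcal{I}_{k\text{ - }\mathsf{thin}}$.
   Context: $\mathcal{W}$ is the van der Waerden ideal on $\mathbb{Z}$: the family of all $A\subseteq\mathbb{Z}$ that do not contain arbitrarily long (finite) arithmetic progressions. For $k\geq 1$, a set $A\subseteq\mathbb{Z}$ is $k$-thin if $|(g+A)\cap A|\leq k$ for every $g\in\mathbb{Z}\setminus\{0\}$, and $\mathcal{I}_{k\text{ - }\mathsf{thin}}$ is the ideal on $\mathbb{Z}$ consisting of all sets contained in a union of finitely many $k$-thin sets. For an ideal $\mathcal{I}$ on $\mathbb{Z}$, a set $X\subseteq\mathbb{Z}$ is $\mathcal{I}$-positive if $X\notin\mathcal{I}$. A colouring $c:[\mathbb{Z}]^2\to 2$ is $\mathbb{Z}$-invariant if $c(\{x,y\})=c(\{x+z,y+z\})$ for all distinct $x,y\in\mathbb{Z}$ and all $z\in\mathbb{Z}$. A set $Y$ is $c$-homogeneous if $c$ is constant on $[Y]^2$. -}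

module Defs where

open import Data.Fin.Base using (Fin)
open import Data.Integer.Base using (ℤ; +_; 0ℤ; _+_; _*_)
open import Data.List.Base using (List; length)
open import Data.List.Relation.Unary.All using (All)
open import Data.List.Relation.Unary.Unique.Propositional using (Unique)
open import Data.Nat.Base as ℕ using (ℕ)
open import Data.Product.Base using (Σ-syntax; ∃-syntax; _×_)
open import Level using (Level; 0ℓ; suc; _⊔_)
open import Relation.Binary.PropositionalEquality using (_≡_; _≢_)
open import Relation.Nullary.Negation using (¬_)
open import Relation.Unary using (Pred; _∈_; _∉_; _⊆_; _∩_; ⋃)

Subset : Set₁
Subset = Pred ℤ 0ℓ

Family : (ℓ : Level) → Set (suc 0ℓ ⊔ suc ℓ)
Family ℓ = Pred Subset ℓ

Positive : ∀ {ℓ} → Family ℓ → Family ℓ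
Positive I X = X ∉ I

ContainsAP : ℕ → Subset → Set
ContainsAP n A =
  ∃[ a ] ∃[ d ] (d ≢ 0ℤ × (∀ i → i ℕ.< n → (a + (+ i) * d) ∈ A))

𝓦 : Family 0ℓ
𝓦 A = ¬ (∀ n → ContainsAP n A)

_⊕_ : ℤ → Subset → Subset
(g ⊕ A) x = ∃[ a ] (a ∈ A × x ≡ g + a)

-- |S| ≤ k, for a set S that is not assumed to be decidable or enumerated:
-- no list of pairwise distinct elements of S is longer than k.
∣_∣≤_ : Subset → ℕ → Set
∣ S ∣≤ k = (xs : List ℤ) → Unique xs → All (_∈ S) xs → length xs ℕ.≤ k

Thin : ℕ → Family 0ℓ
Thin k A = (g : ℤ) → g ≢ 0ℤ → ∣ (g ⊕ A) ∩ A ∣≤ k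

𝓘-thin : ℕ → Family (suc 0ℓ)
𝓘-thin k A =
  ∃[ n ] Σ[ B ∈ (Fin n → Subset) ] ((∀ i → B i ∈ Thin k) × A ⊆ ⋃ (Fin n) B)

-- A map [ℤ]² → 2, given as a function of ordered pairs that is symmetric off
-- the diagonal.  Its diagonal values are junk: everything below reads `colour`
-- at distinct arguments only.
record Colouring : Set where
  field
    colour    : ℤ → ℤ → Fin 2
    symmetric : ∀ x y → x ≢ y → colour x y ≡ colour y x

open Colouring public

Invariant : Colouring → Set
Invariant c = ∀ x y z → x ≢ y → colour c x y ≡ colour c (x + z) (y + z)

-- "c is constant on [Y]²" is expressed as "any two values agree", so that
-- homogeneity does not come with a chosen colour when [Y]² may be empty.
Homogeneous : Colouring → Subset → Set
Homogeneous c Y =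
  ∀ {x y x′ y′} → x ∈ Y → y ∈ Y → x ≢ y → x′ ∈ Y → y′ ∈ Y → x′ ≢ y′ →
  colour c x y ≡ colour c x′ y′

{-# OPTIONS --safe #-}

-- Colour {x, y} by the parity of the 2-adic valuation of x - y.
--
-- (1) X = ℤ works: d and 2d have different colours, so a homogeneous set has no
-- three-term arithmetic progression.
--
-- (2) X = {64^i + 8·64^j} works for every k.  Base-8 digits show that p - p′ = q - q′
-- with p ≠ p′ and p ≠ q is possible in X only if p, p′, q, q′ are the four corners
-- of a rectangle of the grid (i, j); its horizontal sides have even valuation and
-- its vertical sides odd valuation, so a homogeneous subset of X contains no
-- rectangle and is itself 1-thin.  If X were covered by n k-thin sets, then each
-- column of the grid would have two of its first n + 1 points in the same set, and
-- more than k columns would agree on these two points and on this set.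
module Submission where

open import Data.Bool.Base using (true; false)
open import Data.Empty using (⊥; ⊥-elim)
open import Data.Fin as Fin using (Fin; zero; suc; toℕ; combine; opposite; fromℕ<)
open import Data.Fin.Properties
  using (pigeonhole; combine-injective; fromℕ<-injective; opposite-involutive)
open import Data.Integer.Base as ℤ using (ℤ; +_; 0ℤ)
import Data.Integer.Properties as ℤ
import Data.Integer.Tactic.RingSolver as ℤ-solver
open import Data.List.Base using (List; []; _∷_; length; map; filter; downFrom)
open import Data.List.Properties using (length-map; filter-accept)
open import Data.List.Relation.Unary.All as All using (All; []; _∷_)
import Data.List.Relation.Unary.All.Properties as All
open import Data.List.Relation.Unary.AllPairs using ([]; _∷_)
open import Data.List.Relation.Unary.Unique.Propositional using (Unique)
import Data.List.Relation.Unary.Unique.Propositional.Properties as Unique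
open import Data.Nat.Base
open import Data.Nat.Binary.Base using (ℕᵇ; zero; 2[1+_]; 1+[2_]; fromℕ)
import Data.Nat.Binary.Properties as ℕᵇ
open import Data.Nat.DivMod using (_%_; [m+kn]%n≡m%n; m<n⇒m%n≡m)
open import Data.Nat.ListAction using (sum)
open import Data.Nat.Properties
open import Data.Nat.Tactic.RingSolver using (solve-∀)
open import Data.Product.Base using (Σ-syntax; ∃-syntax; ∃₂; _×_; _,_; proj₁; proj₂)
open import Data.Sum.Base using (_⊎_; inj₁; inj₂)
open import Data.Unit.Base using (tt)
open import Function.Base using (_∘_; case_of_)
open import Relation.Binary.Definitions using (tri<; tri≈; tri>)
open import Relation.Binary.PropositionalEquality hiding ([_])
open import Relation.Nullary.Decidable using (does)
open import Relation.Nullary.Negation using (¬_; contradiction)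
open import Relation.Unary using (Pred; Decidable; _∈_; _⊆_; _∩_; U)
open import Defs

-- Parity of the 2-adic valuation.

-- The parity of the 2-adic valuation of 1 + x.
parity₂-suc : ℕᵇ → Fin 2
parity₂-suc zero     = zero
parity₂-suc 2[1+ x ] = zero
parity₂-suc 1+[2 x ] = opposite (parity₂-suc x)

-- The parity of the 2-adic valuation; its value at 0 is junk.
parity₂ : ℕ → Fin 2
parity₂ zero    = zero
parity₂ (suc n) = parity₂-suc (fromℕ n)

-- Both sides have the same image under the injective `toℕ`. Bijective binary lets `parity₂-suc`
-- recurse structurally: its last clause reads 1 + (1 + 2x) as 2(1 + x), one factor of two more than
-- 1 + x.
fromℕ-1+2* : ∀ n → fromℕ (1 + 2 * n) ≡ 1+[2 fromℕ n ]
fromℕ-1+2* n = ℕᵇ.toℕ-injective (trans (ℕᵇ.toℕ-fromℕ (1 + 2 * n))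
  (cong (λ m → 1 + 2 * m) (sym (ℕᵇ.toℕ-fromℕ n))))

fromℕ-2*1+ : ∀ n → fromℕ (2 * suc n) ≡ 2[1+ fromℕ n ]
fromℕ-2*1+ n = ℕᵇ.toℕ-injective (trans (ℕᵇ.toℕ-fromℕ (2 * suc n))
  (cong (λ m → 2 * suc m) (sym (ℕᵇ.toℕ-fromℕ n))))

parity₂-odd : ∀ n → parity₂ (1 + 2 * n) ≡ zero
parity₂-odd zero    = refl
parity₂-odd (suc n) = cong parity₂-suc (fromℕ-2*1+ n)

parity₂-double : ∀ n → .{{NonZero n}} → parity₂ (2 * n) ≡ opposite (parity₂ n)
parity₂-double (suc n) = begin
  parity₂ (2 * suc n)         ≡⟨ cong parity₂ (*-suc 2 n) ⟩
  parity₂ (2 + 2 * n)         ≡⟨ cong parity₂-suc (fromℕ-1+2* n) ⟩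
  opposite (parity₂ (suc n))  ∎
  where open ≡-Reasoning

opposite-≢ : (v : Fin 2) → opposite v ≢ v
opposite-≢ zero       ()
opposite-≢ (suc zero) ()

-- Three doublings flip the parity three times, which amounts to one flip; the six doublings in 64
-- restore it.
parity₂-8* : ∀ n → .{{NonZero n}} → parity₂ (8 * n) ≡ opposite (parity₂ n)
parity₂-8* n = begin
  parity₂ (8 * n)                          ≡⟨ cong parity₂ 8*n≡ ⟩
  parity₂ (2 * (2 * (2 * n)))              ≡⟨ parity₂-double (2 * (2 * n)) ⟩
  opposite (parity₂ (2 * (2 * n)))         ≡⟨ cong opposite (parity₂-double (2 * n)) ⟩
  opposite (opposite (parity₂ (2 * n)))    ≡⟨ opposite-involutive _ ⟩
  parity₂ (2 * n)                          ≡⟨ parity₂-double n ⟩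
  opposite (parity₂ n)                     ∎
  where
  open ≡-Reasoning
  8*n≡ : 8 * n ≡ 2 * (2 * (2 * n))
  8*n≡ = trans (*-assoc 2 4 n) (cong (2 *_) (*-assoc 2 2 n))
  instance
    2n≢0 : NonZero (2 * n)
    2n≢0 = m*n≢0 2 n
    4n≢0 : NonZero (2 * (2 * n))
    4n≢0 = m*n≢0 2 (2 * n)

parity₂-64* : ∀ n → .{{NonZero n}} → parity₂ (64 * n) ≡ parity₂ n
parity₂-64* n = begin
  parity₂ (64 * n)                  ≡⟨ cong parity₂ (*-assoc 8 8 n) ⟩
  parity₂ (8 * (8 * n))             ≡⟨ parity₂-8* (8 * n) ⟩
  opposite (parity₂ (8 * n))        ≡⟨ cong opposite (parity₂-8* n) ⟩
  opposite (opposite (parity₂ n))   ≡⟨ opposite-involutive _ ⟩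
  parity₂ n                         ∎
  where
  open ≡-Reasoning
  instance
    8n≢0 : NonZero (8 * n)
    8n≢0 = m*n≢0 8 n

64^≡1+ : ∀ n → ∃[ m ] 64 ^ n ≡ suc m
64^≡1+ n = pred (64 ^ n) , sym (suc-pred (64 ^ n) {{m^n≢0 64 n}})

64^-injective : ∀ {i j} → 64 ^ i ≡ 64 ^ j → i ≡ j
64^-injective {i} {j} eq with <-cmp i j
... | tri< i<j _ _ = contradiction eq (<⇒≢ (^-monoʳ-< 64 (s≤s (s≤s z≤n)) i<j))
... | tri≈ _ i≡j _ = i≡j
... | tri> _ _ j<i = contradiction (sym eq) (<⇒≢ (^-monoʳ-< 64 (s≤s (s≤s z≤n)) j<i))

distance-nonZero : ∀ {m n} → m ≢ n → NonZero ∣ m - n ∣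
distance-nonZero m≢n = ≢-nonZero (m≢n ∘ ∣m-n∣≡0⇒m≡n)

-- Common factors 64 preserve the parity; once they are removed, one power is 1 and the other is
-- divisible by 64, so the distance is odd.
parity₂-∣64^-64^∣ : ∀ {i j} → i ≢ j → parity₂ ∣ 64 ^ i - 64 ^ j ∣ ≡ zero
parity₂-∣64^-64^∣ {zero}  {zero}  i≢j = contradiction refl i≢j
parity₂-∣64^-64^∣ {zero}  {suc j} _   = odd j
  where
  odd : ∀ j → parity₂ ∣ 1 - 64 ^ suc j ∣ ≡ zero
  -- With 64^j = 1 + m the distance is 63 + 64m = 1 + 2(31 + 32m).
  odd j with m , eq ← 64^≡1+ j rewrite eq =
    trans (cong (λ n → parity₂ ∣ 1 - n ∣) (64*-odd m)) (parity₂-odd (31 + 32 * m))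
    where
    64*-odd : ∀ m → 64 * suc m ≡ 1 + (1 + 2 * (31 + 32 * m))
    64*-odd = solve-∀
parity₂-∣64^-64^∣ {suc i} {zero}  i≢j =
  trans (cong parity₂ (∣-∣-comm (64 ^ suc i) 1)) (parity₂-∣64^-64^∣ {zero} (i≢j ∘ sym))
parity₂-∣64^-64^∣ {suc i} {suc j} i≢j = begin
  parity₂ ∣ 64 * 64 ^ i - 64 * 64 ^ j ∣  ≡⟨ cong parity₂ (*-distribˡ-∣-∣ 64 (64 ^ i) (64 ^ j)) ⟨
  parity₂ (64 * ∣ 64 ^ i - 64 ^ j ∣)     ≡⟨ parity₂-64* _ {{distance-nonZero (i′≢j′ ∘ 64^-injective)}} ⟩
  parity₂ ∣ 64 ^ i - 64 ^ j ∣            ≡⟨ parity₂-∣64^-64^∣ i′≢j′ ⟩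
  zero                                   ∎
  where
  open ≡-Reasoning
  i′≢j′ : i ≢ j
  i′≢j′ = i≢j ∘ cong suc

-- The colouring and three-term progressions.

valuation-colouring : Colouring
valuation-colouring = record
  { colour    = λ x y → parity₂ ℤ.∣ x ℤ.- y ∣
  ; symmetric = λ x y _ → cong parity₂ (ℤ.∣i-j∣≡∣j-i∣ x y)
  }

valuation-colouring-invariant : Invariant valuation-colouring
valuation-colouring-invariant x y z _ = cong (parity₂ ∘ ℤ.∣_∣) (translate x y z)
  where
  translate : ∀ x y z → x ℤ.- y ≡ (x ℤ.+ z) ℤ.- (y ℤ.+ z)
  translate = ℤ-solver.solve-∀

homogeneous⇒𝓦 : ∀ Y → Homogeneous valuation-colouring Y → Y ∈ 𝓦
homogeneous⇒𝓦 Y hom aps with a , d , d≢0 , mem ← aps 3 =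
  opposite-≢ (parity₂ ℤ.∣ d ∣) (begin
    opposite (parity₂ ℤ.∣ d ∣)        ≡⟨ parity₂-double ℤ.∣ d ∣ ⟨
    parity₂ (2 * ℤ.∣ d ∣)             ≡⟨ cong parity₂ (distance 2) ⟨
    colour valuation-colouring (term 0) (term 2)
      ≡⟨ hom (mem 0 z<s) (mem 2 (s<s (s<s z<s))) (distinct 2)
             (mem 0 z<s) (mem 1 (s<s z<s)) (distinct 1) ⟩
    colour valuation-colouring (term 0) (term 1)
                                      ≡⟨ cong parity₂ (distance 1) ⟩
    parity₂ (1 * ℤ.∣ d ∣)             ≡⟨ cong parity₂ (*-identityˡ ℤ.∣ d ∣) ⟩
    parity₂ ℤ.∣ d ∣                   ∎)
  where
  open ≡-Reasoning
  term : ℕ → ℤ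
  term n = a ℤ.+ (+ n) ℤ.* d

  instance
    d-nonZero : NonZero ℤ.∣ d ∣
    d-nonZero = ≢-nonZero (d≢0 ∘ ℤ.∣i∣≡0⇒i≡0)

  difference : ∀ a d e → (a ℤ.+ 0ℤ ℤ.* d) ℤ.- (a ℤ.+ e ℤ.* d) ≡ ℤ.- (e ℤ.* d)
  difference = ℤ-solver.solve-∀

  distance : ∀ n → ℤ.∣ term 0 ℤ.- term n ∣ ≡ n * ℤ.∣ d ∣
  distance n = begin
    ℤ.∣ term 0 ℤ.- term n ∣   ≡⟨ cong ℤ.∣_∣ (difference a d (+ n)) ⟩
    ℤ.∣ ℤ.- ((+ n) ℤ.* d) ∣   ≡⟨ ℤ.∣-i∣≡∣i∣ ((+ n) ℤ.* d) ⟩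
    ℤ.∣ (+ n) ℤ.* d ∣         ≡⟨ ℤ.abs-* (+ n) d ⟩
    n * ℤ.∣ d ∣               ∎

  distinct : ∀ n → .{{NonZero n}} → term 0 ≢ term n
  distinct n eq = ≢-nonZero⁻¹ (n * ℤ.∣ d ∣) {{m*n≢0 n ℤ.∣ d ∣}}
    (trans (sym (distance n)) (cong ℤ.∣_∣ (ℤ.i≡j⇒i-j≡0 eq)))

-- Base-8 digits and sums of two grid points.

-- In base 8 the first index marks the even position 2i and the second the odd position 2j + 1, so
-- the two never interfere.
grid : ℕ → ℕ → ℕ
grid i j = 64 ^ i + 8 * 64 ^ j

Grid : Subset
Grid z = ∃₂ λ i j → z ≡ + grid i j

-- The Kronecker delta, with values in ℕ so that it can be summed, and recursive so that shifting
-- both arguments holds by computation.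
[_≡_] : ℕ → ℕ → ℕ
[ zero  ≡ zero  ] = 1
[ zero  ≡ suc _ ] = 0
[ suc _ ≡ zero  ] = 0
[ suc m ≡ suc n ] = [ m ≡ n ]

[n≡n]≡1 : ∀ n → [ n ≡ n ] ≡ 1
[n≡n]≡1 zero    = refl
[n≡n]≡1 (suc n) = [n≡n]≡1 n

[m≡n]-cases : ∀ m n → m ≡ n ⊎ [ m ≡ n ] ≡ 0
[m≡n]-cases zero    zero    = inj₁ refl
[m≡n]-cases zero    (suc n) = inj₂ refl
[m≡n]-cases (suc m) zero    = inj₂ refl
[m≡n]-cases (suc m) (suc n) with [m≡n]-cases m n
... | inj₁ refl = inj₁ refl
... | inj₂ eq   = inj₂ eq

count : ℕ → List ℕ → ℕ
count n xs = sum (map [ n ≡_] xs)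

count≤length : ∀ n xs → count n xs ≤ length xs
count≤length n []       = z≤n
count≤length n (x ∷ xs) = +-mono-≤ ([m≡n]≤1 n x) (count≤length n xs)
  where
  [m≡n]≤1 : ∀ m n → [ m ≡ n ] ≤ 1
  [m≡n]≤1 zero    zero    = ≤-refl
  [m≡n]≤1 zero    (suc n) = z≤n
  [m≡n]≤1 (suc m) zero    = z≤n
  [m≡n]≤1 (suc m) (suc n) = [m≡n]≤1 m n

-- Division by 64 on lists of exponents: zeros are dropped, since they form the remainder `count 0`.
preds : List ℕ → List ℕ
preds []           = []
preds (zero  ∷ xs) = preds xs
preds (suc n ∷ xs) = n ∷ preds xs

length-preds : ∀ xs → length (preds xs) ≤ length xs
length-preds []           = z≤n
length-preds (zero  ∷ xs) = m≤n⇒m≤1+n (length-preds xs)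
length-preds (suc _ ∷ xs) = s≤s (length-preds xs)

count-preds : ∀ n xs → count n (preds xs) ≡ count (suc n) xs
count-preds n []           = refl
count-preds n (zero  ∷ xs) = count-preds n xs
count-preds n (suc m ∷ xs) = cong (λ k → [ n ≡ m ] + k) (count-preds n xs)

Σ64^ : List ℕ → ℕ
Σ64^ xs = sum (map (64 ^_) xs)

Σ64^-preds : ∀ xs → Σ64^ xs ≡ count 0 xs + 64 * Σ64^ (preds xs)
Σ64^-preds []           = refl
Σ64^-preds (zero  ∷ xs) = cong suc (Σ64^-preds xs)
Σ64^-preds (suc n ∷ xs) = trans (cong (λ k → 64 * 64 ^ n + k) (Σ64^-preds xs))
  (regroup (64 ^ n) (count 0 xs) (Σ64^ (preds xs)))
  where
  regroup : ∀ a b c → 64 * a + (b + 64 * c) ≡ b + 64 * (a + c)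
  regroup = solve-∀

-- The even base-8 digits are the multiplicities in xs and the odd ones those in ys,
-- so dividing by 8 turns (xs, ys) into (ys, preds xs).
interleave : List ℕ → List ℕ → ℕ
interleave xs ys = Σ64^ xs + 8 * Σ64^ ys

interleave-preds : ∀ xs ys → interleave xs ys ≡ count 0 xs + interleave ys (preds xs) * 8
interleave-preds xs ys = trans (cong (_+ 8 * Σ64^ ys) (Σ64^-preds xs))
  (regroup (count 0 xs) (Σ64^ (preds xs)) (Σ64^ ys))
  where
  regroup : ∀ a b c → a + 64 * b + 8 * c ≡ a + (c + 8 * b) * 8
  regroup = solve-∀

remainder-quotient-unique : ∀ {r r′} q q′ n → .{{_ : NonZero n}} → r < n → r′ < n →
  r + q * n ≡ r′ + q′ * n → r ≡ r′ × q ≡ q′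
remainder-quotient-unique {r} {r′} q q′ n r<n r′<n eq = r≡r′ ,
  *-cancelʳ-≡ q q′ n (+-cancelˡ-≡ r _ _ (trans eq (cong (_+ q′ * n) (sym r≡r′))))
  where
  open ≡-Reasoning
  r≡r′ : r ≡ r′
  r≡r′ = begin
    r                  ≡⟨ m<n⇒m%n≡m r<n ⟨
    r % n              ≡⟨ [m+kn]%n≡m%n r q n ⟨
    (r + q * n) % n    ≡⟨ cong (_% n) eq ⟩
    (r′ + q′ * n) % n  ≡⟨ [m+kn]%n≡m%n r′ q′ n ⟩
    r′ % n             ≡⟨ m<n⇒m%n≡m r′<n ⟩
    r′                 ∎

-- Fewer than 8 exponents keep `count 0` below 8, so it is the remainder modulo 8 and nothing is
-- carried.
lowest-digit : ∀ {xs ys xs′ ys′} → length xs < 8 → length xs′ < 8 →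
  interleave xs ys ≡ interleave xs′ ys′ →
  count 0 xs ≡ count 0 xs′ × interleave ys (preds xs) ≡ interleave ys′ (preds xs′)
lowest-digit {xs} {ys} {xs′} {ys′} l l′ eq =
  remainder-quotient-unique (interleave ys (preds xs)) (interleave ys′ (preds xs′)) 8
    (≤-<-trans (count≤length 0 xs) l) (≤-<-trans (count≤length 0 xs′) l′)
    (trans (sym (interleave-preds xs ys)) (trans eq (interleave-preds xs′ ys′)))

-- Two divisions by 8 expose one digit of each list and replace both lists by their `preds`, which
-- lowers the digit index `n` by one.
interleave-digits : ∀ n {xs ys xs′ ys′} →
  length xs < 8 → length ys < 8 → length xs′ < 8 → length ys′ < 8 →
  interleave xs ys ≡ interleave xs′ ys′ →
  count n xs ≡ count n xs′ × count n ys ≡ count n ys′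
interleave-digits zero {xs} {ys} {xs′} {ys′} lx ly lx′ ly′ eq =
  let x₀ , eq₁ = lowest-digit {xs} {ys} {xs′} {ys′} lx lx′ eq
      y₀ , _   = lowest-digit {ys} {preds xs} {ys′} {preds xs′} ly ly′ eq₁
  in x₀ , y₀
interleave-digits (suc n) {xs} {ys} {xs′} {ys′} lx ly lx′ ly′ eq =
  let _ , eq₁ = lowest-digit {xs} {ys} {xs′} {ys′} lx lx′ eq
      _ , eq₂ = lowest-digit {ys} {preds xs} {ys′} {preds xs′} ly ly′ eq₁
      xₙ , yₙ = interleave-digits n {preds xs} {preds ys} {preds xs′} {preds ys′}
        (≤-<-trans (length-preds xs) lx) (≤-<-trans (length-preds ys) ly)
        (≤-<-trans (length-preds xs′) lx′) (≤-<-trans (length-preds ys′) ly′) eq₂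
  in trans (sym (count-preds n xs)) (trans xₙ (count-preds n xs′)) ,
     trans (sym (count-preds n ys)) (trans yₙ (count-preds n ys′))

count-injective₁ : ∀ {a b} → (∀ n → count n (a ∷ []) ≡ count n (b ∷ [])) → a ≡ b
count-injective₁ {a} {b} eq with [m≡n]-cases a b
... | inj₁ a≡b    = a≡b
... | inj₂ [ab]≡0 =
  contradiction (trans (sym (cong (_+ 0) ([n≡n]≡1 a))) (trans (eq a) (cong (_+ 0) [ab]≡0))) λ ()

-- Counting at `a` gives a positive number on the left, so `a` is `c` or `d`; cancelling it leaves
-- one element on each side.
count-injective₂ : ∀ {a b c d} → (∀ n → count n (a ∷ b ∷ []) ≡ count n (c ∷ d ∷ [])) →
  (a ≡ c × b ≡ d) ⊎ (a ≡ d × b ≡ c)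
count-injective₂ {a} {b} {c} {d} eq with [m≡n]-cases a c
... | inj₁ refl = inj₁ (refl , count-injective₁ λ n → +-cancelˡ-≡ [ n ≡ a ] _ _ (eq n))
... | inj₂ [ac]≡0 with [m≡n]-cases a d
...   | inj₁ refl = inj₂ (refl , count-injective₁ λ n →
          +-cancelˡ-≡ [ n ≡ a ] _ _ (trans (eq n) (swap [ n ≡ c ] [ n ≡ a ])))
  where
  swap : ∀ u v → u + (v + 0) ≡ v + (u + 0)
  swap = solve-∀
...   | inj₂ [ad]≡0 = contradiction
          (trans (sym (cong (_+ count a (b ∷ [])) ([n≡n]≡1 a)))
            (trans (eq a) (cong₂ (λ u v → u + (v + 0)) [ac]≡0 [ad]≡0)))
          λ ()

-- The digits of such a sum are at most 2. They recover the first indices and the second indices as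
-- two separate multisets; nothing ties the two matchings together, which is how rectangles arise.
grid-sum-injective : ∀ {i₁ j₁ i₂ j₂ i₃ j₃ i₄ j₄} →
  grid i₁ j₁ + grid i₂ j₂ ≡ grid i₃ j₃ + grid i₄ j₄ →
  ((i₁ ≡ i₃ × i₂ ≡ i₄) ⊎ (i₁ ≡ i₄ × i₂ ≡ i₃)) × ((j₁ ≡ j₃ × j₂ ≡ j₄) ⊎ (j₁ ≡ j₄ × j₂ ≡ j₃))
grid-sum-injective {i₁} {j₁} {i₂} {j₂} {i₃} {j₃} {i₄} {j₄} eq =
  count-injective₂ (proj₁ ∘ digits) , count-injective₂ (proj₂ ∘ digits)
  where
  regroup : ∀ a b c d → (a + 8 * b) + (c + 8 * d) ≡ (a + (c + 0)) + 8 * (b + (d + 0))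
  regroup = solve-∀
  2<8 : 2 < 8
  2<8 = s<s (s<s z<s)
  digits : ∀ n → count n (i₁ ∷ i₂ ∷ []) ≡ count n (i₃ ∷ i₄ ∷ []) ×
                 count n (j₁ ∷ j₂ ∷ []) ≡ count n (j₃ ∷ j₄ ∷ [])
  digits n = interleave-digits n {i₁ ∷ i₂ ∷ []} {j₁ ∷ j₂ ∷ []} {i₃ ∷ i₄ ∷ []} {j₃ ∷ j₄ ∷ []}
    2<8 2<8 2<8 2<8
    (trans (sym (regroup (64 ^ i₁) (64 ^ j₁) (64 ^ i₂) (64 ^ j₂)))
      (trans eq (regroup (64 ^ i₃) (64 ^ j₃) (64 ^ i₄) (64 ^ j₄))))

grid-injectiveʳ : ∀ i {j j′} → grid i j ≡ grid i j′ → j ≡ j′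
grid-injectiveʳ i eq = 64^-injective (*-cancelˡ-≡ _ _ 8 (+-cancelˡ-≡ (64 ^ i) _ _ eq))

-- Homogeneous subsets of the grid.

colour-+ : ∀ m n → colour valuation-colouring (+ m) (+ n) ≡ parity₂ ∣ m - n ∣
colour-+ m n = cong parity₂ (trans (cong ℤ.∣_∣ (ℤ.m-n≡m⊖n m n)) (∣⊖∣ m n))
  where
  ∣⊖∣ : ∀ m n → ℤ.∣ m ℤ.⊖ n ∣ ≡ ∣ m - n ∣
  ∣⊖∣ m n with ≤-total m n
  ... | inj₁ m≤n = trans (ℤ.∣⊖∣-≤ m≤n) (sym (m≤n⇒∣m-n∣≡n∸m m≤n))
  ... | inj₂ n≤m = trans (ℤ.∣m⊖n∣≡∣n⊖m∣ m n)
    (trans (ℤ.∣⊖∣-≤ n≤m) (trans (sym (m≤n⇒∣m-n∣≡n∸m n≤m)) (∣-∣-comm n m)))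

grid-row-colour : ∀ i i′ j → i ≢ i′ →
  colour valuation-colouring (+ grid i j) (+ grid i′ j) ≡ zero
grid-row-colour i i′ j i≢i′ = begin
  colour valuation-colouring (+ grid i j) (+ grid i′ j)  ≡⟨ colour-+ (grid i j) (grid i′ j) ⟩
  parity₂ ∣ grid i j - grid i′ j ∣
    ≡⟨ cong₂ (λ m n → parity₂ ∣ m - n ∣) (+-comm (64 ^ i) _) (+-comm (64 ^ i′) _) ⟩
  parity₂ ∣ 8 * 64 ^ j + 64 ^ i - 8 * 64 ^ j + 64 ^ i′ ∣
    ≡⟨ cong parity₂ (∣m+n-m+o∣≡∣n-o∣ (8 * 64 ^ j) (64 ^ i) (64 ^ i′)) ⟩
  parity₂ ∣ 64 ^ i - 64 ^ i′ ∣                           ≡⟨ parity₂-∣64^-64^∣ i≢i′ ⟩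
  zero                                                   ∎
  where open ≡-Reasoning

grid-column-colour : ∀ i j j′ → j ≢ j′ →
  colour valuation-colouring (+ grid i j) (+ grid i j′) ≡ opposite zero
grid-column-colour i j j′ j≢j′ = begin
  colour valuation-colouring (+ grid i j) (+ grid i j′)  ≡⟨ colour-+ (grid i j) (grid i j′) ⟩
  parity₂ ∣ grid i j - grid i j′ ∣
    ≡⟨ cong parity₂ (∣m+n-m+o∣≡∣n-o∣ (64 ^ i) (8 * 64 ^ j) (8 * 64 ^ j′)) ⟩
  parity₂ ∣ 8 * 64 ^ j - 8 * 64 ^ j′ ∣  ≡⟨ cong parity₂ (*-distribˡ-∣-∣ 8 (64 ^ j) (64 ^ j′)) ⟨
  parity₂ (8 * ∣ 64 ^ j - 64 ^ j′ ∣)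
    ≡⟨ parity₂-8* _ {{distance-nonZero (j≢j′ ∘ 64^-injective)}} ⟩
  opposite (parity₂ ∣ 64 ^ j - 64 ^ j′ ∣)                ≡⟨ cong opposite (parity₂-∣64^-64^∣ j≢j′) ⟩
  opposite zero                                          ∎
  where open ≡-Reasoning

homogeneous⇒no-corner : ∀ {Y} → Homogeneous valuation-colouring Y →
  ∀ i i′ j j′ → + grid i j ∈ Y → + grid i′ j ∈ Y → + grid i j′ ∈ Y →
  + grid i j ≢ + grid i′ j → + grid i j ≢ + grid i j′ → ⊥
homogeneous⇒no-corner hom i i′ j j′ p r c p≢r p≢c = contradiction
  (trans (sym (grid-row-colour i i′ j (λ { refl → p≢r refl })))
    (trans (hom p r p≢r p c p≢c) (grid-column-colour i j j′ (λ { refl → p≢c refl }))))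
  λ ()

-- If the matchings of first and second indices agree, `p` is `q` or `p′`; if they differ, the four
-- points form a rectangle with a corner at `p`.
homogeneous⇒Sidon : ∀ {Y} → Homogeneous valuation-colouring Y → Y ⊆ Grid →
  ∀ {p q p′ q′} → p ∈ Y → q ∈ Y → p′ ∈ Y → q′ ∈ Y → p ℤ.+ q′ ≡ q ℤ.+ p′ → p ≢ q → p ≢ p′ → ⊥
homogeneous⇒Sidon hom Y⊆Grid p∈Y q∈Y p′∈Y q′∈Y sum≡ p≢q p≢p′
  with i₁ , j₁ , refl ← Y⊆Grid p∈Y | i₂ , j₂ , refl ← Y⊆Grid q′∈Y
     | i₃ , j₃ , refl ← Y⊆Grid q∈Y | i₄ , j₄ , refl ← Y⊆Grid p′∈Y
  = cases (grid-sum-injective {i₁} {j₁} {i₂} {j₂} {i₃} {j₃} {i₄} {j₄} (ℤ.+-injective sum≡))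
  where
  cases : ((i₁ ≡ i₃ × i₂ ≡ i₄) ⊎ (i₁ ≡ i₄ × i₂ ≡ i₃)) ×
          ((j₁ ≡ j₃ × j₂ ≡ j₄) ⊎ (j₁ ≡ j₄ × j₂ ≡ j₃)) → ⊥
  cases (inj₁ (refl , _) , inj₁ (refl , _)) = p≢q refl
  cases (inj₂ (refl , _) , inj₂ (refl , _)) = p≢p′ refl
  -- Here `q` shares the first index with `p` and `p′` shares the second; in the last case they
  -- exchange roles.
  cases (inj₁ (refl , _) , inj₂ (refl , _)) =
    homogeneous⇒no-corner hom i₁ i₄ j₁ j₃ p∈Y p′∈Y q∈Y p≢p′ p≢q
  cases (inj₂ (refl , _) , inj₁ (refl , _)) =
    homogeneous⇒no-corner hom i₁ i₃ j₁ j₄ p∈Y q∈Y p′∈Y p≢q p≢p′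

-- Distinct `p` and `q` in the intersection, shifted back by `g` to `p′` and `q′`, have equal
-- differences, against the Sidon property.
homogeneous⇒thin : ∀ Y → Homogeneous valuation-colouring Y → Y ⊆ Grid → Y ∈ Thin 1
homogeneous⇒thin Y hom Y⊆Grid g g≢0 []       _ _ = z≤n
homogeneous⇒thin Y hom Y⊆Grid g g≢0 (_ ∷ []) _ _ = s≤s z≤n
homogeneous⇒thin Y hom Y⊆Grid g g≢0 (p ∷ q ∷ _) ((p≢q ∷ _) ∷ _)
  (((p′ , p′∈Y , p≡g+p′) , p∈Y) ∷ ((q′ , q′∈Y , q≡g+q′) , q∈Y) ∷ _) =
  ⊥-elim (homogeneous⇒Sidon hom Y⊆Grid p∈Y q∈Y p′∈Y q′∈Y p+q′≡q+p′ p≢q p≢p′)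
  where
  cancel : ∀ g x → g ≡ (g ℤ.+ x) ℤ.- x
  cancel = ℤ-solver.solve-∀

  exchange : ∀ g x y → (g ℤ.+ x) ℤ.+ y ≡ (g ℤ.+ y) ℤ.+ x
  exchange = ℤ-solver.solve-∀

  p≢p′ : p ≢ p′
  p≢p′ p≡p′ = g≢0 (trans (cancel g p′) (ℤ.i≡j⇒i-j≡0 (trans (sym p≡g+p′) p≡p′)))

  p+q′≡q+p′ : p ℤ.+ q′ ≡ q ℤ.+ p′
  p+q′≡q+p′ = trans (cong (ℤ._+ q′) p≡g+p′)
    (trans (exchange g p′ q′) (cong (ℤ._+ p′) (sym q≡g+q′)))

thin-mono : ∀ {k l A} → k ≤ l → A ∈ Thin k → A ∈ Thin l
thin-mono k≤l thin g g≢0 xs unique all = ≤-trans (thin g g≢0 xs unique all) k≤l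

-- Positivity of the grid by the pigeonhole principle.

length-filter-∷ : ∀ {a p} {A : Set a} {P : Pred A p} (P? : Decidable P) x xs →
  length (filter P? xs) ≤ length (filter P? (x ∷ xs))
length-filter-∷ P? x xs with does (P? x)
... | true  = n≤1+n _
... | false = ≤-refl

-- The map taking j to f j and the number of earlier occurrences of f j is injective.
fibres-unbounded : ∀ {m} k (f : ℕ → Fin m) →
  ¬ (∀ j₀ xs → Unique xs → All (λ j → f j ≡ f j₀) xs → length xs ≤ k)
-- If fibres have at most `k` elements, ranks lie in 0, ..., k, so there are `m * suc k` pairs of
-- value and rank; one more argument forces a collision.
fibres-unbounded {m} k f bounded = case pigeonhole (n<1+n (m * suc k)) (ranked ∘ toℕ) of
  λ (a , b , a<b , eq) →
    let fa≡fb , rank≡ = combine-injective (f (toℕ a)) _ (f (toℕ b)) _ eq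
    in <⇒≢ (rank-< a<b fa≡fb) (fromℕ<-injective (rank (toℕ a)) (rank (toℕ b))
         (rank<1+k (toℕ a)) (rank<1+k (toℕ b)) rank≡)
  where
  earlier : Fin m → ℕ → List ℕ
  earlier v j = filter (λ i → f i Fin.≟ v) (downFrom j)

  rank : ℕ → ℕ
  rank j = length (earlier (f j) j)

  rank<1+k : ∀ j → rank j < suc k
  rank<1+k j = s≤s (bounded j (earlier (f j) j)
    (Unique.filter⁺ (λ i → f i Fin.≟ f j) (Unique.downFrom⁺ j))
    (All.all-filter (λ i → f i Fin.≟ f j) (downFrom j)))

  ranked : ℕ → Fin (m * suc k)
  ranked j = combine (f j) (fromℕ< (rank<1+k j))

  earlier-mono : ∀ v {a b} → a ≤′ b → length (earlier v a) ≤ length (earlier v b)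
  earlier-mono v (≤′-reflexive refl) = ≤-refl
  earlier-mono v (≤′-step {n} a≤n)   = ≤-trans (earlier-mono v a≤n)
    (length-filter-∷ (λ i → f i Fin.≟ v) n (downFrom n))

  rank-< : ∀ {a b} → a < b → f a ≡ f b → rank a < rank b
  rank-< {a} {b} a<b fa≡fb = begin
    suc (length (earlier (f a) a))
      -- Past `a`, the point `a` itself counts as an earlier occurrence, which makes the inequality
      -- strict.
      ≡⟨ cong length (filter-accept (λ i → f i Fin.≟ f a) {a} {downFrom a} refl) ⟨
    length (earlier (f a) (suc a))  ≤⟨ earlier-mono (f a) (≤⇒≤′ a<b) ⟩
    length (earlier (f a) b)        ≡⟨ cong (λ v → length (earlier v b)) fa≡fb ⟩
    length (earlier (f b) b)        ∎
    where open ≤-Reasoning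

Grid-positive : ∀ k → Grid ∈ Positive (𝓘-thin k)
Grid-positive k (n , B , thin , cover) = fibres-unbounded k pattern-of bounded
  where
  cell : ℕ → ℕ → Fin n
  cell i j = proj₁ (cover (i , j , refl))

  cell-∈ : ∀ i j → + grid i j ∈ B (cell i j)
  cell-∈ i j = proj₂ (cover (i , j , refl))

  repetition : ∀ j → ∃₂ λ (i i′ : Fin (suc n)) → i Fin.< i′ × cell (toℕ i) j ≡ cell (toℕ i′) j
  repetition j = pigeonhole (n<1+n n) (λ i → cell (toℕ i) j)

  low high : ℕ → Fin (suc n)
  low j  = proj₁ (repetition j)
  high j = proj₁ (proj₂ (repetition j))

  colour-of : ℕ → Fin n
  colour-of j = cell (toℕ (low j)) j

  -- The triple of two first indices and their common set, packed into one `Fin` so that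
  -- `fibres-unbounded` applies.
  pattern-of : ℕ → Fin (suc n * suc n * n)
  pattern-of j = combine (combine (low j) (high j)) (colour-of j)

  bounded : ∀ j₀ xs → Unique xs → All (λ j → pattern-of j ≡ pattern-of j₀) xs → length xs ≤ k
  bounded j₀ xs unique same = subst (_≤ k) (length-map point xs)
    (thin (colour-of j₀) g g≢0 (map point xs)
      (Unique.map⁺ (grid-injectiveʳ i′ ∘ ℤ.+-injective) unique)
      (All.map⁺ (All.map point-∈ same)))
    where
    i i′ : ℕ
    i  = toℕ (low j₀)
    i′ = toℕ (high j₀)

    i≢i′ : i ≢ i′
    i≢i′ = <⇒≢ (proj₁ (proj₂ (proj₂ (repetition j₀))))

    -- This shift takes `grid i j` to `grid i′ j` for every `j` at once, so all columns with the
    -- same pattern contribute to one intersection.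
    g : ℤ
    g = + (64 ^ i′) ℤ.- + (64 ^ i)

    g≢0 : g ≢ 0ℤ
    g≢0 g≡0 = i≢i′ (sym (64^-injective (ℤ.+-injective (ℤ.i-j≡0⇒i≡j _ _ g≡0))))

    point : ℕ → ℤ
    point j = + grid i′ j

    shift : ∀ a b c → a ℤ.+ c ≡ (a ℤ.- b) ℤ.+ (b ℤ.+ c)
    shift = ℤ-solver.solve-∀

    point-∈ : ∀ {j} → pattern-of j ≡ pattern-of j₀ →
      point j ∈ (g ⊕ B (colour-of j₀)) ∩ B (colour-of j₀)
    point-∈ {j} eq
      with rows≡ , colour≡ ←
             combine-injective (combine (low j) (high j)) (colour-of j)
               (combine (low j₀) (high j₀)) (colour-of j₀) eq
      with low≡ , high≡ ←
             combine-injective (low j) (high j) (low j₀) (high j₀) rows≡ =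
      (+ grid i j ,
        subst₂ (λ a v → + grid (toℕ a) j ∈ B v) low≡ colour≡ (cell-∈ (toℕ (low j)) j) ,
        shift (+ (64 ^ i′)) (+ (64 ^ i)) (+ (8 * 64 ^ j))) ,
      -- The upper point lies in the same set as the lower one by the choice of `repetition j`.
      subst₂ (λ a v → + grid (toℕ a) j ∈ B v) high≡
        (trans (sym (proj₂ (proj₂ (proj₂ (repetition j))))) colour≡)
        (cell-∈ (toℕ (high j)) j)

theorem3p6 : (Σ[ X ∈ Subset ] Σ[ c ∈ Colouring ]
    (X ∈ Positive 𝓦 × Invariant c ×
    (∀ (Y : Subset) → Homogeneous c Y → Y ⊆ X → Y ∈ 𝓦)))
    ×
    (∀ (k : ℕ) → 1 ≤ k →
    Σ[ X ∈ Subset ] Σ[ c ∈ Colouring ]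
    (X ∈ Positive (𝓘-thin k) × Invariant c ×
    (∀ (Y : Subset) → Homogeneous c Y → Y ⊆ X → Y ∈ 𝓘-thin k)))
theorem3p6 =
  (U , valuation-colouring ,
    -- The progression 0, 1, 2, ... serves for every length.
    (λ U∈𝓦 → U∈𝓦 λ _ → 0ℤ , ℤ.1ℤ , (λ ()) , λ _ _ → tt) ,
    valuation-colouring-invariant , λ Y hom _ → homogeneous⇒𝓦 Y hom) ,
  λ k 1≤k → Grid , valuation-colouring , Grid-positive k , valuation-colouring-invariant ,
    -- `Y` is covered by itself alone, and 1-thin implies `k`-thin because 1 ≤ k.
    λ Y hom Y⊆Grid → 1 , (λ _ → Y) ,
      (λ _ → thin-mono {A = Y} 1≤k (homogeneous⇒thin Y hom Y⊆Grid)) , λ y∈Y → zero , y∈Y
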